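{- Let $\mathbb F$ be an algebraically closed field and $V$ a vector space over $\mathbb F$ of dimension $d+1$ with $d\ge3$. Let $\Phi=(A;\{E_i\}_{i=0}^d;A^*;\{E^*_i\}_{i=0}^d)$ be a Leonard system on $V$, with dual eigenvalue sequence $\{\theta^*_i\}_{i=0}^d$, and let $a_i=\mathrm{tr}(E^*_iA)$ for $0\le i\le d$. Then the following are equivalent: (i) ${\mathcal Z}(\Phi)\ne0$; (ii) there exist scalars $f_0,f_1,f_2,f_3\in\mathbb F$ (not all zero) such that $f_0+f_1\theta^*_i+f_2a_i+f_3a_i\theta^*_i=0$ for $0\le i\le d$.
   Context: A tridiagonal matrix is irreducible if all entries on its subdiagonal and superdiagonal are nonzero. A Leonard pair on $V$ is an ordered pair $A,A^*\in \mathrm{End}(V)$ such that (i) there is a basis of $V$ with respect to which $A$ is irreducible tridiagonal and $A^*$ is diagonal; (ii) there is a basis of $V$ with respect to which $A^*$ is irreducible tridiagonal and $A$ is diagonal. Then $A,A^*$ are multiplicity-free (diagonalizable with one-dimensional eigenspaces). The primitive idempotent of $A$ for an eigenvalue $\theta$ is the projection onto the $\theta$-eigenspace along the sum of the other eigenspaces. An ordering of the eigenvalues of $A$ (and the corresponding ordering $\{E_i\}_{i=0}^d$ of primitive idempotents) is standard if corresponding eigenvectors $v_0,\dots,v_d$, in this order, form a basis as in (ii). Standard orderings for $A^*$ are defined similarly using (i). A Leonard system on $V$ is a sequence $\Phi=(A;\{E_i\}_{i=0}^d;A^*;\{E^*_i\}_{i=0}^d)$ where $A,A^*$ is a Leonard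 pair on $V$ and $\{E_i\}$, $\{E^*_i\}$ are standard orderings of the primitive idempotents of $A$, $A^*$. The dual eigenvalue sequence $\{\theta^*_i\}$ is given by $A^*E^*_i=\theta^*_iE^*_i$. Zero diagonal space: ${\mathcal Z}(\Phi)$ is the set of $X\in\mathrm{Span}\{I,A^*,A,AA^*\}$ such that $E^*_iXE^*_i=0$ for $0\le i\le d$. Known fact: $I,A^*,A,AA^*,A^*A$ are linearly independent. -}

module Defs where

open import Algebra.Bundles using (CommutativeMonoid; CommutativeRing; Semiring)
open import Algebra.Module.Bundles using (Module)
open import Algebra.Module.Morphism.Structures using (module ModuleMorphisms)
import Algebra.Definitions
import Algebra.Definitions.RawMonoid
import Algebra.Definitions.RawSemiring
import Algebra.Module.Morphism.Construct.Composition as Composition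
import Algebra.Module.Morphism.Construct.Identity as Identity
import Algebra.Properties.CommutativeSemigroup
open import Data.Fin.Base using (Fin; toℕ; fromℕ)
open import Data.Nat.Base using (ℕ; suc; _<_; ∣_-_∣)
open import Data.Product.Base using (∃; ∃₂; ∃-syntax; _×_; _,_; proj₁; proj₂)
open import Level using (_⊔_)
open import Relation.Binary.PropositionalEquality.Core using (_≡_)
open import Relation.Nullary.Negation.Core using (¬_)

module _ {r ℓr} (F : CommutativeRing r ℓr) where
  open CommutativeRing F
  open Algebra.Definitions _≈_ using (Invertible)
  open Algebra.Definitions.RawSemiring (Semiring.rawSemiring semiring) using (sum; _^_)

  -- Equality is not assumed decidable; classically these are exactly the
  -- fields.
  record IsField : Set (r ⊔ ℓr) where
    field
      1≉0        : 1# ≉ 0#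
      invertible : ∀ x → x ≉ 0# → Invertible 1# _*_ x

  -- c lists the coefficients of a polynomial of degree exactly suc n,
  -- constant term first.
  IsAlgebraicallyClosed : Set (r ⊔ ℓr)
  IsAlgebraicallyClosed =
    ∀ n (c : Fin (suc (suc n)) → Carrier) → c (fromℕ (suc n)) ≉ 0# →
    ∃[ x ] sum (λ i → c i * x ^ toℕ i) ≈ 0#

  Matrix : ℕ → Set r
  Matrix n = Fin n → Fin n → Carrier

  IsDiagonal : ∀ {n} → Matrix n → Set ℓr
  IsDiagonal M = ∀ i j → ¬ (i ≡ j) → M i j ≈ 0#

  record IsIrreducibleTridiagonal {n} (M : Matrix n) : Set ℓr where
    field
      tridiagonal : ∀ i j → 1 < ∣ toℕ i - toℕ j ∣ → M i j ≈ 0#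
      irreducible : ∀ i j → ∣ toℕ i - toℕ j ∣ ≡ 1 → M i j ≉ 0#

module _ {r ℓr m ℓm} {F : CommutativeRing r ℓr} (V : Module F m ℓm) where
  open CommutativeRing F
  open Module V
  open ModuleMorphisms rawModule rawModule using (IsModuleHomomorphism)
  open Algebra.Definitions.RawMonoid +ᴹ-rawMonoid using () renaming (sum to sumᴹ)

  record Basis (n : ℕ) : Set (r ⊔ ℓr ⊔ m ⊔ ℓm) where
    field
      vec      : Fin n → Carrierᴹ
      spanning : ∀ v → ∃ λ (c : Fin n → Carrier) → v ≈ᴹ sumᴹ (λ i → c i *ₗ vec i)
      linIndep : ∀ (c : Fin n → Carrier) → sumᴹ (λ i → c i *ₗ vec i) ≈ᴹ 0ᴹ → ∀ i → c i ≈ 0#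

    coord : Carrierᴹ → Fin n → Carrier
    coord v = proj₁ (spanning v)

  record End : Set (r ⊔ m ⊔ ℓm) where
    field
      ⟦_⟧      : Carrierᴹ → Carrierᴹ
      isLinear : IsModuleHomomorphism ⟦_⟧

    open IsModuleHomomorphism isLinear public

module _ {r ℓr m ℓm} {F : CommutativeRing r ℓr} {V : Module F m ℓm} where
  open CommutativeRing F
  open Module V
  open ModuleMorphisms rawModule rawModule using (IsModuleHomomorphism)
  open Algebra.Definitions.RawMonoid +-rawMonoid using (sum)
  open Algebra.Definitions.RawMonoid +ᴹ-rawMonoid using () renaming (sum to sumᴹ)
  open End using (⟦_⟧)

  private
    module +ᴹ = Algebra.Properties.CommutativeSemigroup
      (CommutativeMonoid.commutativeSemigroup +ᴹ-commutativeMonoid)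

    -- A map with these properties also respects 0ᴹ, -ᴹ_ and _*ᵣ_.
    linear : (f : Carrierᴹ → Carrierᴹ) →
             (∀ {u v} → u ≈ᴹ v → f u ≈ᴹ f v) →
             (∀ u v → f (u +ᴹ v) ≈ᴹ f u +ᴹ f v) →
             (∀ c v → f (c *ₗ v) ≈ᴹ c *ₗ f v) →
             End V
    linear f cong homo scale = record
      { ⟦_⟧      = f
      ; isLinear = record
        { isBimoduleHomomorphism = record
          { +ᴹ-isGroupHomomorphism = record
            { isMonoidHomomorphism = record
              { isMagmaHomomorphism = record
                { isRelHomomorphism = record { cong = cong }
                ; homo              = homo
                }
              ; ε-homo = f0
              }
            ; ⁻¹-homo = λ v → uniqueʳ‿-ᴹ (f v) (f (-ᴹ v))
                (≈ᴹ-trans (≈ᴹ-sym (homo v (-ᴹ v)))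
                  (≈ᴹ-trans (cong (-ᴹ‿inverseʳ v)) f0))
            }
          ; *ₗ-homo = scale
          ; *ᵣ-homo = λ c v → ≈ᴹ-trans (cong (≈ᴹ-sym (*ₗ-*ᵣ-coincident c v)))
                        (≈ᴹ-trans (scale c v) (*ₗ-*ᵣ-coincident c (f v)))
          }
        }
      }
      where
      f0 : f 0ᴹ ≈ᴹ 0ᴹ
      f0 = ≈ᴹ-trans (cong (≈ᴹ-sym (*ₗ-zeroˡ 0ᴹ)))
             (≈ᴹ-trans (scale 0# 0ᴹ) (*ₗ-zeroˡ (f 0ᴹ)))

  infix  4 _≈ᴱ_
  infixl 6 _+ᴱ_
  infixr 7 _·ᴱ_
  infixr 9 _∘ᴱ_

  _≈ᴱ_ : End V → End V → Set (m ⊔ ℓm)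
  X ≈ᴱ Y = ∀ v → ⟦ X ⟧ v ≈ᴹ ⟦ Y ⟧ v

  0ᴱ : End V
  0ᴱ = linear (λ _ → 0ᴹ) (λ _ → ≈ᴹ-refl) (λ _ _ → ≈ᴹ-sym (+ᴹ-identityˡ 0ᴹ))
         (λ c _ → ≈ᴹ-sym (*ₗ-zeroʳ c))

  idᴱ : End V
  idᴱ = record { isLinear = Identity.isModuleHomomorphism rawModule ≈ᴹ-refl }

  _∘ᴱ_ : End V → End V → End V
  X ∘ᴱ Y = record
    { isLinear = Composition.isModuleHomomorphism ≈ᴹ-trans
        (End.isLinear Y) (End.isLinear X) }

  _+ᴱ_ : End V → End V → End V
  X +ᴱ Y = linear (λ v → ⟦ X ⟧ v +ᴹ ⟦ Y ⟧ v)
    (λ u≈v → +ᴹ-cong (End.⟦⟧-cong X u≈v) (End.⟦⟧-cong Y u≈v))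
    (λ u v → ≈ᴹ-trans (+ᴹ-cong (End.+ᴹ-homo X u v) (End.+ᴹ-homo Y u v))
               (+ᴹ.interchange _ _ _ _))
    (λ c v → ≈ᴹ-trans (+ᴹ-cong (End.*ₗ-homo X c v) (End.*ₗ-homo Y c v))
               (≈ᴹ-sym (*ₗ-distribˡ c _ _)))

  _·ᴱ_ : Carrier → End V → End V
  a ·ᴱ X = linear (λ v → a *ₗ ⟦ X ⟧ v)
    (λ u≈v → *ₗ-cong refl (End.⟦⟧-cong X u≈v))
    (λ u v → ≈ᴹ-trans (*ₗ-cong refl (End.+ᴹ-homo X u v)) (*ₗ-distribˡ a _ _))
    (λ c v → ≈ᴹ-trans (*ₗ-cong refl (End.*ₗ-homo X c v))
      (≈ᴹ-trans (≈ᴹ-sym (*ₗ-assoc a c _))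
        (≈ᴹ-trans (*ₗ-cong (*-comm a c) ≈ᴹ-refl) (*ₗ-assoc c a _))))

  -- Column j holds the coordinates of X (vec j).
  matrix : ∀ {n} → Basis V n → End V → Matrix F n
  matrix b X i j = Basis.coord b (⟦ X ⟧ (Basis.vec b j)) i

  -- The value does not depend on the basis.
  trace : ∀ {n} → Basis V n → End V → Carrier
  trace b X = sum (λ i → matrix b X i i)

  Eigenspace : End V → Carrier → Carrierᴹ → Set ℓm
  Eigenspace A θ v = ⟦ A ⟧ v ≈ᴹ θ *ₗ v

  IsEigenvalue : End V → Carrier → Set (m ⊔ ℓm)
  IsEigenvalue A θ = ∃[ v ] (v ≉ᴹ 0ᴹ × Eigenspace A θ v)

  SumOfOtherEigenspaces : End V → Carrier → Carrierᴹ → Set (r ⊔ ℓr ⊔ m ⊔ ℓm)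
  SumOfOtherEigenspaces A θ u =
    ∃₂ λ (k : ℕ) (x : Fin k → Carrierᴹ) →
      (∀ i → ∃[ θ′ ] (θ′ ≉ θ × Eigenspace A θ′ (x i))) × u ≈ᴹ sumᴹ x

  -- E is the projection onto W along U; directness of the sum W + U follows
  -- from fixes and kills.
  record IsProjection {w u} (W : Carrierᴹ → Set w) (U : Carrierᴹ → Set u)
                      (E : End V) : Set (m ⊔ ℓm ⊔ w ⊔ u) where
    field
      decompose : ∀ v → ∃₂ λ x y → W x × U y × v ≈ᴹ x +ᴹ y
      fixes     : ∀ x → W x → ⟦ E ⟧ x ≈ᴹ x
      kills     : ∀ y → U y → ⟦ E ⟧ y ≈ᴹ 0ᴹ

  IsPrimitiveIdempotent : End V → Carrier → End V → Set (r ⊔ ℓr ⊔ m ⊔ ℓm)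
  IsPrimitiveIdempotent A θ E =
    IsEigenvalue A θ ×
    IsProjection (Eigenspace A θ) (SumOfOtherEigenspaces A θ) E

  record IsEigenvalueOrdering {n} (A : End V) (θ : Fin n → Carrier)
                              : Set (r ⊔ ℓr ⊔ m ⊔ ℓm) where
    field
      eigenvalue : ∀ i → IsEigenvalue A (θ i)
      distinct   : ∀ i j → θ i ≈ θ j → i ≡ j
      exhaustive : ∀ η → IsEigenvalue A η → ∃[ i ] η ≈ θ i

  TridiagonalDiagonal : ∀ {n} → Basis V n → End V → End V → Set ℓr
  TridiagonalDiagonal b X Y =
    IsIrreducibleTridiagonal F (matrix b X) × IsDiagonal F (matrix b Y)

  IsLeonardPair : ℕ → End V → End V → Set (r ⊔ ℓr ⊔ m ⊔ ℓm)
  IsLeonardPair n A A* =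
    (∃ λ (b : Basis V n) → TridiagonalDiagonal b A A*) ×
    (∃ λ (b : Basis V n) → TridiagonalDiagonal b A* A)

  -- E is a standard ordering of the primitive idempotents of A, where A*
  -- is the other member of the Leonard pair.
  record IsStandardOrdering {n} (A A* : End V) (E : Fin n → End V)
                            : Set (r ⊔ ℓr ⊔ m ⊔ ℓm) where
    field
      θ            : Fin n → Carrier
      ordering     : IsEigenvalueOrdering A θ
      idempotent   : ∀ i → IsPrimitiveIdempotent A (θ i) (E i)
      basis        : Basis V n
      eigenvectors : ∀ i → Eigenspace A (θ i) (Basis.vec basis i)
      standard     : TridiagonalDiagonal basis A* A

module _ {r ℓr m ℓm} {F : CommutativeRing r ℓr} (V : Module F m ℓm) where

  record LeonardSystem (d : ℕ) : Set (r ⊔ ℓr ⊔ m ⊔ ℓm) where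
    field
      A           : End V
      E           : Fin (suc d) → End V
      A*          : End V
      E*          : Fin (suc d) → End V
      leonardPair : IsLeonardPair (suc d) A A*
      standardE   : IsStandardOrdering A A* E
      standardE*  : IsStandardOrdering A* A E*

module _ {r ℓr m ℓm} {F : CommutativeRing r ℓr} {V : Module F m ℓm}
         {d : ℕ} (Φ : LeonardSystem V d) where
  open CommutativeRing F
  open LeonardSystem Φ

  IsDualEigenvalueSequence : (Fin (suc d) → Carrier) → Set (m ⊔ ℓm)
  IsDualEigenvalueSequence θ* = ∀ i → A* ∘ᴱ E* i ≈ᴱ θ* i ·ᴱ E* i

  InSpan : End V → Set (r ⊔ m ⊔ ℓm)
  InSpan X = ∃₂ λ f₀ f₁ → ∃₂ λ f₂ f₃ →
    X ≈ᴱ f₀ ·ᴱ idᴱ +ᴱ f₁ ·ᴱ A* +ᴱ f₂ ·ᴱ A +ᴱ f₃ ·ᴱ (A ∘ᴱ A*)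

  ZeroDiagonalSpace : End V → Set (r ⊔ m ⊔ ℓm)
  ZeroDiagonalSpace X = InSpan X × (∀ i → E* i ∘ᴱ X ∘ᴱ E* i ≈ᴱ 0ᴱ)

{-# OPTIONS --safe #-}

-- Let eᵢ be eigenvectors of A* as in the standard ordering. Then E*ᵢ v is the
-- i-th coordinate of v times eᵢ, so aᵢ is the diagonal entry Aᵢᵢ, and E*ᵢXE*ᵢ
-- vanishes iff Xᵢᵢ does. For X = f₀I + f₁A* + f₂A + f₃AA* one has
--   X eⱼ = (f₀ + f₁θ*ⱼ) eⱼ + (f₂ + f₃θ*ⱼ) A eⱼ,
-- whose j-th coordinate is the expression in (ii). If X = 0, the coordinate
-- j+1 gives f₂ + f₃θ*ⱼ = 0, and then the coordinate j gives f₀ + f₁θ*ⱼ = 0;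
-- j = 0, 1 suffice to conclude f₀ = f₁ = f₂ = f₃ = 0.

module Submission where

open import Defs
open import Algebra.Bundles using (CommutativeMonoid; CommutativeRing; Monoid)
open import Algebra.Module.Bundles using (Module)
import Algebra.Module.Properties
import Algebra.Properties.AbelianGroup
import Algebra.Properties.CommutativeMonoid.Sum
import Algebra.Properties.CommutativeSemigroup
import Algebra.Properties.Monoid.Sum
open import Algebra.Morphism.Construct.Composition using (isMonoidHomomorphism)
open import Algebra.Morphism.Structures using (IsMonoidHomomorphism)
open import Data.Fin.Base using (Fin; suc)
open import Data.Fin.Patterns using (0F; 1F; 2F)
open import Data.Fin.Properties using (punchInᵢ≢i)
open import Data.Nat.Base using (ℕ; suc; _≤_; s≤s)
open import Data.Nat.Properties using (≤-trans; n≤1+n)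
open import Data.Product.Base using (∃; ∃₂; _×_; _,_; proj₁; proj₂)
open import Data.Vec.Functional using (Vector; replicate; removeAt; updateAt)
open import Data.Vec.Functional.Properties using (updateAt-updates; updateAt-minimal)
open import Function.Base using (_∘_; const)
open import Function.Bundles using (_⇔_; mk⇔)
import Relation.Binary.Reasoning.Setoid as ≈-Reasoning
open import Relation.Binary.PropositionalEquality.Core as ≡ using (_≡_; _≢_)
open import Relation.Nullary.Negation.Core using (¬_)

open End using (⟦_⟧)

-- Finite sums in monoids.

module _ {a ℓ} (M : CommutativeMonoid a ℓ) where
  open CommutativeMonoid M
  open Algebra.Properties.CommutativeMonoid.Sum M
  open ≈-Reasoning setoid

  sum-single : ∀ {n} (t : Vector Carrier n) i → (∀ k → k ≢ i → t k ≈ ε) → sum t ≈ t i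
  sum-single {suc n} t i t≈ε = begin
    sum t                    ≈⟨ sum-remove t ⟩
    t i ∙ sum (removeAt t i) ≈⟨ ∙-congˡ (sum-cong-≋ (λ k → t≈ε _ (punchInᵢ≢i i k))) ⟩
    t i ∙ sum (replicate n ε) ≈⟨ ∙-congˡ (sum-replicate-zero n) ⟩
    t i ∙ ε                  ≈⟨ identityʳ (t i) ⟩
    t i                      ∎

module _ {a b ℓ₁ ℓ₂} (M : Monoid a ℓ₁) (N : Monoid b ℓ₂) where
  private
    module M where
      open Monoid M public
      open Algebra.Properties.Monoid.Sum M public using (sum)
    module N where
      open Monoid N public
      open Algebra.Properties.Monoid.Sum N public using (sum)

  -- Two separate monoids are allowed because this serves both endomorphisms of `V` and linear
  -- functionals from `V` to `F`.
  sum-homo : ∀ {f} → IsMonoidHomomorphism M.rawMonoid N.rawMonoid f →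
             ∀ {n} (t : Vector M.Carrier n) → f (M.sum t) N.≈ N.sum (f ∘ t)
  sum-homo h {0}     t = IsMonoidHomomorphism.ε-homo h
  sum-homo h {suc n} t = N.trans (IsMonoidHomomorphism.homo h _ _)
    (N.∙-congˡ (sum-homo h (t ∘ suc)))

-- Cancellation and affine functions over a field.

module _ {r ℓr} (F : CommutativeRing r ℓr) (isField : IsField F) where
  open CommutativeRing F
  open IsField isField
  open Algebra.Properties.AbelianGroup +-abelianGroup using (x∙y⁻¹≈ε⇒x≈y; identityˡ-unique)
  open ≈-Reasoning setoid

  *-cancel-zeroʳ : ∀ {x y} → y ≉ 0# → x * y ≈ 0# → x ≈ 0#
  *-cancel-zeroʳ {x} {y} y≉0 xy≈0 with invertible y y≉0
  ... | y⁻¹ , _ , yy⁻¹≈1 = begin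
    x             ≈⟨ *-identityʳ x ⟨
    x * 1#        ≈⟨ *-congˡ yy⁻¹≈1 ⟨
    x * (y * y⁻¹) ≈⟨ *-assoc x y y⁻¹ ⟨
    (x * y) * y⁻¹ ≈⟨ *-congʳ xy≈0 ⟩
    0# * y⁻¹      ≈⟨ zeroˡ y⁻¹ ⟩
    0#            ∎

  -- Adding `q * (x - y)` to `p + q * y` gives `p + q * x`. Both of these are zero, so `q * (x - y)`
  -- is zero, and `x - y` can be cancelled because it is nonzero.
  affine-zero : ∀ {p q x y} → x ≉ y → p + q * x ≈ 0# → p + q * y ≈ 0# →
                p ≈ 0# × q ≈ 0#
  affine-zero {p} {q} {x} {y} x≉y px≈0 py≈0 = p≈0 , q≈0
    where
    q*[x-y]≈0 : q * (x - y) ≈ 0#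
    q*[x-y]≈0 = identityˡ-unique _ (p + q * y) (begin
      q * (x - y) + (p + q * y)   ≈⟨ +-comm _ _ ⟩
      (p + q * y) + q * (x - y)   ≈⟨ +-assoc p _ _ ⟩
      p + (q * y + q * (x - y))   ≈⟨ +-congˡ (distribˡ q y (x - y)) ⟨
      p + q * (y + (x - y))       ≈⟨ +-congˡ (*-congˡ (+-comm y (x - y))) ⟩
      p + q * ((x - y) + y)       ≈⟨ +-congˡ (*-congˡ (+-assoc x (- y) y)) ⟩
      p + q * (x + (- y + y))     ≈⟨ +-congˡ (*-congˡ (+-congˡ (-‿inverseˡ y))) ⟩
      p + q * (x + 0#)            ≈⟨ +-congˡ (*-congˡ (+-identityʳ x)) ⟩
      p + q * x                   ≈⟨ trans px≈0 (sym py≈0) ⟩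
      p + q * y                   ∎)

    q≈0 : q ≈ 0#
    q≈0 = *-cancel-zeroʳ (x≉y ∘ x∙y⁻¹≈ε⇒x≈y x y) q*[x-y]≈0

    p≈0 : p ≈ 0#
    p≈0 = begin
      p          ≈⟨ +-identityʳ p ⟨
      p + 0#     ≈⟨ +-congˡ (trans (*-congʳ q≈0) (zeroˡ x)) ⟨
      p + q * x  ≈⟨ px≈0 ⟩
      0#         ∎

module _ {r ℓr m ℓm} {F : CommutativeRing r ℓr} {V : Module F m ℓm} where
  open CommutativeRing F
  open Module V
  private
    module V-Sum = Algebra.Properties.CommutativeMonoid.Sum +ᴹ-commutativeMonoid
    module F-Sum = Algebra.Properties.CommutativeMonoid.Sum +-commutativeMonoid
    module V-Group = Algebra.Properties.AbelianGroup +ᴹ-abelianGroup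
    module F-Group = Algebra.Properties.AbelianGroup +-abelianGroup

  -- Coordinates and traces with respect to a basis.

  module _ {n} (B : Basis V n) where
    open Basis B

    combination : Vector Carrier n → Carrierᴹ
    combination c = V-Sum.sum (λ i → c i *ₗ vec i)

    combination-homo-+ : ∀ c d → combination (λ i → c i + d i) ≈ᴹ combination c +ᴹ combination d
    combination-homo-+ c d = ≈ᴹ-trans
      (V-Sum.sum-cong-≋ (λ i → *ₗ-distribʳ (vec i) (c i) (d i)))
      (V-Sum.∑-distrib-+ (λ i → c i *ₗ vec i) (λ i → d i *ₗ vec i))

    combination-homo-*ₗ : ∀ x c → combination (λ i → x * c i) ≈ᴹ x *ₗ combination c
    combination-homo-*ₗ x c = ≈ᴹ-trans
      (V-Sum.sum-cong-≋ (λ i → *ₗ-assoc x (c i) (vec i)))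
      -- Scaling by `x` is the endomorphism `x ·ᴱ idᴱ`, so it passes through the sum.
      (≈ᴹ-sym (sum-homo +ᴹ-monoid +ᴹ-monoid
        (End.+ᴹ-isMonoidHomomorphism (x ·ᴱ idᴱ {V = V})) (λ i → c i *ₗ vec i)))

    -- `coord` is only a choice of coefficients made by `spanning`. Linear independence, applied to
    -- the difference of two expansions, pins it down; that it respects equality and is linear then
    -- follows.
    coord-unique : ∀ {v c} → v ≈ᴹ combination c → ∀ i → coord v i ≈ c i
    coord-unique {v} {c} v≈c i = F-Group.x∙y⁻¹≈ε⇒x≈y (coord v i) (c i)
      (linIndep _ (V-Group.identityˡ-unique _ (combination c) (begin
        combination (λ k → coord v k - c k) +ᴹ combination c
          ≈⟨ combination-homo-+ (λ k → coord v k - c k) c ⟨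
        combination (λ k → coord v k - c k + c k)
          ≈⟨ V-Sum.sum-cong-≋ (λ k → *ₗ-congʳ (F-Group.//-rightDividesˡ (c k) (coord v k))) ⟩
        combination (coord v)
          ≈⟨ proj₂ (spanning v) ⟨
        v
          ≈⟨ v≈c ⟩
        combination c ∎)) i)
      where open ≈-Reasoning ≈ᴹ-setoid

    coord-cong : ∀ {u v} → u ≈ᴹ v → ∀ i → coord u i ≈ coord v i
    coord-cong {v = v} u≈v = coord-unique (≈ᴹ-trans u≈v (proj₂ (spanning v)))

    coord-homo-+ : ∀ u v i → coord (u +ᴹ v) i ≈ coord u i + coord v i
    coord-homo-+ u v = coord-unique (≈ᴹ-trans
      (+ᴹ-cong (proj₂ (spanning u)) (proj₂ (spanning v)))
      (≈ᴹ-sym (combination-homo-+ (coord u) (coord v))))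

    coord-homo-*ₗ : ∀ x v i → coord (x *ₗ v) i ≈ x * coord v i
    coord-homo-*ₗ x v = coord-unique (≈ᴹ-trans
      (*ₗ-congˡ (proj₂ (spanning v)))
      (≈ᴹ-sym (combination-homo-*ₗ x (coord v))))

    coord-0 : ∀ i → coord 0ᴹ i ≈ 0#
    coord-0 i = trans (coord-cong (≈ᴹ-sym (*ₗ-zeroˡ 0ᴹ)) i)
      (trans (coord-homo-*ₗ 0# 0ᴹ i) (zeroˡ _))

    coord-isMonoidHomomorphism : ∀ i →
      IsMonoidHomomorphism +ᴹ-rawMonoid +-rawMonoid (λ v → coord v i)
    coord-isMonoidHomomorphism i = record
      { isMagmaHomomorphism = record
        { isRelHomomorphism = record { cong = λ u≈v → coord-cong u≈v i }
        ; homo              = λ u v → coord-homo-+ u v i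
        }
      ; ε-homo = coord-0 i
      }

    private
      unit : Fin n → Vector Carrier n
      unit j = updateAt (replicate n 0#) j (const 1#)

      unit-combination : ∀ j → vec j ≈ᴹ combination (unit j)
      unit-combination j = begin
        vec j             ≈⟨ *ₗ-identityˡ (vec j) ⟨
        1# *ₗ vec j       ≈⟨ *ₗ-congʳ (reflexive (updateAt-updates j (replicate n 0#))) ⟨
        unit j j *ₗ vec j ≈⟨ sum-single +ᴹ-commutativeMonoid (λ k → unit j k *ₗ vec k) j (λ k k≢j →
          ≈ᴹ-trans (*ₗ-congʳ (reflexive (updateAt-minimal k j (replicate n 0#) k≢j)))
            (*ₗ-zeroˡ (vec k))) ⟨
        combination (unit j) ∎
        where open ≈-Reasoning ≈ᴹ-setoid

    coord-vec-≡ : ∀ j → coord (vec j) j ≈ 1#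
    coord-vec-≡ j = trans (coord-unique (unit-combination j) j)
      (reflexive (updateAt-updates j (replicate n 0#)))

    coord-vec-≢ : ∀ {i j} → i ≢ j → coord (vec j) i ≈ 0#
    coord-vec-≢ {i} {j} i≢j = trans (coord-unique (unit-combination j) i)
      (reflexive (updateAt-minimal i j (replicate n 0#) i≢j))

    -- The `j`-th coordinate recovers the scalar, so no division is involved.
    *ₗ-vec-cancel : ∀ {x y} j → x *ₗ vec j ≈ᴹ y *ₗ vec j → x ≈ y
    *ₗ-vec-cancel {x} {y} j xv≈yv = begin
      x                    ≈⟨ coord-*ₗ-vec x ⟨
      coord (x *ₗ vec j) j ≈⟨ coord-cong xv≈yv j ⟩
      coord (y *ₗ vec j) j ≈⟨ coord-*ₗ-vec y ⟩
      y                    ∎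
      where
      open ≈-Reasoning setoid
      coord-*ₗ-vec : ∀ z → coord (z *ₗ vec j) j ≈ z
      coord-*ₗ-vec z = trans (coord-homo-*ₗ z (vec j) j)
        (trans (*-congˡ (coord-vec-≡ j)) (*-identityʳ z))

    -- The `j`-th diagonal entry is `φ (vec j) * coord u j`. By linearity the sum of these is `φ`
    -- applied to the expansion of `u`. The value does not mention `B`, which lets traces be taken
    -- in an arbitrary basis.
    trace-rank-one : ∀ {φ} → IsMonoidHomomorphism +ᴹ-rawMonoid +-rawMonoid φ →
      (∀ x v → φ (x *ₗ v) ≈ x * φ v) →
      ∀ X u → (∀ v → ⟦ X ⟧ v ≈ᴹ φ v *ₗ u) → trace B X ≈ φ u
    trace-rank-one {φ} φ-homo φ-homo-*ₗ X u X≈φu = begin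
      F-Sum.sum (λ j → coord (⟦ X ⟧ (vec j)) j)
        ≈⟨ F-Sum.sum-cong-≋ (λ j → trans (coord-cong (X≈φu (vec j)) j) (coord-homo-*ₗ _ u j)) ⟩
      F-Sum.sum (λ j → φ (vec j) * coord u j)
        ≈⟨ F-Sum.sum-cong-≋ (λ j → trans (*-comm _ _) (sym (φ-homo-*ₗ (coord u j) (vec j)))) ⟩
      F-Sum.sum (λ j → φ (coord u j *ₗ vec j))
        ≈⟨ sum-homo +ᴹ-monoid +-monoid φ-homo (λ j → coord u j *ₗ vec j) ⟨
      φ (combination (coord u))
        ≈⟨ IsMonoidHomomorphism.⟦⟧-cong φ-homo (proj₂ (spanning u)) ⟨
      φ u ∎
      where open ≈-Reasoning setoid

  -- Primitive idempotents in the standard eigenbasis.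

  module _ {n} {A B : End V} {E : Fin n → End V} (S : IsStandardOrdering A B E) where
    open IsStandardOrdering S
    open IsEigenvalueOrdering ordering
    open Basis basis

    idempotent-vec-≡ : ∀ i → ⟦ E i ⟧ (vec i) ≈ᴹ vec i
    idempotent-vec-≡ i = IsProjection.fixes (proj₂ (idempotent i)) (vec i) (eigenvectors i)

    idempotent-vec-≢ : ∀ {i k} → k ≢ i → ⟦ E i ⟧ (vec k) ≈ᴹ 0ᴹ
    idempotent-vec-≢ {i} {k} k≢i = IsProjection.kills (proj₂ (idempotent i)) (vec k)
      -- `vec k` is itself a one-term sum of eigenvectors for eigenvalues other than `θ i`.
      (1 , const (vec k)
         , (λ _ → θ k , (λ θₖ≈θᵢ → k≢i (distinct k i θₖ≈θᵢ)) , eigenvectors k)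
         , ≈ᴹ-sym (+ᴹ-identityʳ (vec k)))

    -- Expand `v` in the eigenbasis: `E i` fixes the `i`-th vector and kills all others. So `E i`
    -- has rank one, with functional the `i`-th coordinate.
    idempotent-coord : ∀ i v → ⟦ E i ⟧ v ≈ᴹ coord v i *ₗ vec i
    idempotent-coord i v = begin
      ⟦ E i ⟧ v
        ≈⟨ End.⟦⟧-cong (E i) (proj₂ (spanning v)) ⟩
      ⟦ E i ⟧ (combination basis (coord v))
        ≈⟨ sum-homo +ᴹ-monoid +ᴹ-monoid (End.+ᴹ-isMonoidHomomorphism (E i)) (λ k → coord v k *ₗ vec k) ⟩
      V-Sum.sum (λ k → ⟦ E i ⟧ (coord v k *ₗ vec k))
        ≈⟨ V-Sum.sum-cong-≋ (λ k → End.*ₗ-homo (E i) (coord v k) (vec k)) ⟩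
      V-Sum.sum (λ k → coord v k *ₗ ⟦ E i ⟧ (vec k))
        ≈⟨ sum-single +ᴹ-commutativeMonoid _ i (λ k k≢i →
             ≈ᴹ-trans (*ₗ-congˡ (idempotent-vec-≢ k≢i)) (*ₗ-zeroʳ (coord v k))) ⟩
      coord v i *ₗ ⟦ E i ⟧ (vec i)
        ≈⟨ *ₗ-congˡ (idempotent-vec-≡ i) ⟩
      coord v i *ₗ vec i ∎
      where open ≈-Reasoning ≈ᴹ-setoid

    -- `E i ∘ᴱ X` sends `v` to the `i`-th coordinate of `X v` times `vec i`. Its trace in any basis
    -- `b` is thus that functional at `vec i`, a diagonal entry in the eigenbasis.
    trace-idempotent : ∀ (b : Basis V n) X i → trace b (E i ∘ᴱ X) ≈ matrix basis X i i
    trace-idempotent b X i = trace-rank-one b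
      (isMonoidHomomorphism trans (End.+ᴹ-isMonoidHomomorphism X)
        (coord-isMonoidHomomorphism basis i))
      (λ x v → trans (coord-cong basis (End.*ₗ-homo X x v) i)
                 (coord-homo-*ₗ basis x (⟦ X ⟧ v) i))
      (E i ∘ᴱ X) (vec i) (λ v → idempotent-coord i (⟦ X ⟧ v))

    -- Using the rank-one form of `E i` on both sides shows that the sandwich is the multiple of
    -- `E i` by the diagonal entry of `X`.
    sandwich-coord : ∀ X i v →
      ⟦ E i ∘ᴱ X ∘ᴱ E i ⟧ v ≈ᴹ (coord v i * matrix basis X i i) *ₗ vec i
    sandwich-coord X i v = ≈ᴹ-trans (idempotent-coord i _) (*ₗ-congʳ (begin
      coord (⟦ X ⟧ (⟦ E i ⟧ v)) i
        ≈⟨ coord-cong basis (End.⟦⟧-cong X (idempotent-coord i v)) i ⟩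
      coord (⟦ X ⟧ (coord v i *ₗ vec i)) i
        ≈⟨ coord-cong basis (End.*ₗ-homo X (coord v i) (vec i)) i ⟩
      coord (coord v i *ₗ ⟦ X ⟧ (vec i)) i
        ≈⟨ coord-homo-*ₗ basis (coord v i) (⟦ X ⟧ (vec i)) i ⟩
      coord v i * matrix basis X i i ∎))
      where open ≈-Reasoning setoid

    diagonal-zero⇒sandwich-zero : ∀ X i → matrix basis X i i ≈ 0# → E i ∘ᴱ X ∘ᴱ E i ≈ᴱ 0ᴱ
    diagonal-zero⇒sandwich-zero X i Xᵢᵢ≈0 v = ≈ᴹ-trans (sandwich-coord X i v)
      (≈ᴹ-trans (*ₗ-congʳ (trans (*-congˡ Xᵢᵢ≈0) (zeroʳ _))) (*ₗ-zeroˡ (vec i)))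

    sandwich-zero⇒diagonal-zero : ∀ X i → E i ∘ᴱ X ∘ᴱ E i ≈ᴱ 0ᴱ → matrix basis X i i ≈ 0#
    -- Evaluate at `vec i`, whose `i`-th coordinate is 1.
    sandwich-zero⇒diagonal-zero X i EXE≈0 = *ₗ-vec-cancel basis i (begin
      matrix basis X i i *ₗ vec i
        ≈⟨ *ₗ-congʳ (trans (*-congʳ (coord-vec-≡ basis i)) (*-identityˡ _)) ⟨
      (coord (vec i) i * matrix basis X i i) *ₗ vec i
        ≈⟨ sandwich-coord X i (vec i) ⟨
      ⟦ E i ∘ᴱ X ∘ᴱ E i ⟧ (vec i)
        ≈⟨ EXE≈0 (vec i) ⟩
      0ᴹ
        ≈⟨ *ₗ-zeroˡ (vec i) ⟨
      0# *ₗ vec i ∎)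
      where open ≈-Reasoning ≈ᴹ-setoid

  -- The combinations of the identity, `A*`, `A` and `A ∘ᴱ A*`.

  spanElement : End V → End V → (f₀ f₁ f₂ f₃ : Carrier) → End V
  spanElement A A* f₀ f₁ f₂ f₃ = f₀ ·ᴱ idᴱ +ᴱ f₁ ·ᴱ A* +ᴱ f₂ ·ᴱ A +ᴱ f₃ ·ᴱ (A ∘ᴱ A*)

  spanElement-eigenvector : ∀ A A* f₀ f₁ f₂ f₃ {η v} → Eigenspace A* η v →
    ⟦ spanElement A A* f₀ f₁ f₂ f₃ ⟧ v ≈ᴹ (f₀ + f₁ * η) *ₗ v +ᴹ (f₂ + f₃ * η) *ₗ ⟦ A ⟧ v
  spanElement-eigenvector A A* f₀ f₁ f₂ f₃ {η} {v} A*v≈ηv = begin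
    f₀ *ₗ v +ᴹ f₁ *ₗ ⟦ A* ⟧ v +ᴹ f₂ *ₗ ⟦ A ⟧ v +ᴹ f₃ *ₗ ⟦ A ⟧ (⟦ A* ⟧ v)
      ≈⟨ +ᴹ-cong
           (+ᴹ-congʳ (+ᴹ-congˡ (≈ᴹ-trans (*ₗ-congˡ A*v≈ηv) (≈ᴹ-sym (*ₗ-assoc f₁ η v)))))
           (≈ᴹ-trans
             (*ₗ-congˡ (≈ᴹ-trans (End.⟦⟧-cong A A*v≈ηv) (End.*ₗ-homo A η v)))
             (≈ᴹ-sym (*ₗ-assoc f₃ η (⟦ A ⟧ v)))) ⟩
    f₀ *ₗ v +ᴹ (f₁ * η) *ₗ v +ᴹ f₂ *ₗ ⟦ A ⟧ v +ᴹ (f₃ * η) *ₗ ⟦ A ⟧ v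
      ≈⟨ +ᴹ-assoc _ _ _ ⟩
    (f₀ *ₗ v +ᴹ (f₁ * η) *ₗ v) +ᴹ (f₂ *ₗ ⟦ A ⟧ v +ᴹ (f₃ * η) *ₗ ⟦ A ⟧ v)
      ≈⟨ +ᴹ-cong (*ₗ-distribʳ v f₀ (f₁ * η)) (*ₗ-distribʳ (⟦ A ⟧ v) f₂ (f₃ * η)) ⟨
    (f₀ + f₁ * η) *ₗ v +ᴹ (f₂ + f₃ * η) *ₗ ⟦ A ⟧ v ∎
    where open ≈-Reasoning ≈ᴹ-setoid

  spanElement-zero : ∀ A A* {f₀ f₁ f₂ f₃} →
    f₀ ≈ 0# × f₁ ≈ 0# × f₂ ≈ 0# × f₃ ≈ 0# → spanElement A A* f₀ f₁ f₂ f₃ ≈ᴱ 0ᴱ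
  spanElement-zero A A* (f₀≈0 , f₁≈0 , f₂≈0 , f₃≈0) v =
    add (add (add (zeroTerm f₀≈0) (zeroTerm f₁≈0)) (zeroTerm f₂≈0)) (zeroTerm f₃≈0)
    where
    open Algebra.Module.Properties V using () renaming (x≈0⇒x*y≈0 to zeroTerm)
    add : ∀ {u w} → u ≈ᴹ 0ᴹ → w ≈ᴹ 0ᴹ → u +ᴹ w ≈ᴹ 0ᴹ
    add u≈0 w≈0 = ≈ᴹ-trans (+ᴹ-cong u≈0 w≈0) (+ᴹ-identityˡ 0ᴹ)

  -- Matrix entries of these combinations in the eigenbasis of `A*`.

  module _ {d} (Φ : LeonardSystem V d) {θ* : Fin (suc d) → Carrier}
           (dual : IsDualEigenvalueSequence Φ θ*) where
    open LeonardSystem Φ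
    open IsStandardOrdering standardE* using (basis; eigenvectors; ordering)
      renaming (θ to η)
    open Basis basis

    -- `θ*` is given only through the identity for `A* ∘ᴱ E* i`. Since `E* i` fixes `vec i`,
    -- evaluating that identity at `vec i` yields the eigenvalue.
    dual-eigenvector : ∀ i → Eigenspace A* (θ* i) (vec i)
    dual-eigenvector i = begin
      ⟦ A* ⟧ (vec i)             ≈⟨ End.⟦⟧-cong A* (idempotent-vec-≡ standardE* i) ⟨
      ⟦ A* ⟧ (⟦ E* i ⟧ (vec i))  ≈⟨ dual i (vec i) ⟩
      θ* i *ₗ ⟦ E* i ⟧ (vec i)   ≈⟨ *ₗ-congˡ (idempotent-vec-≡ standardE* i) ⟩
      θ* i *ₗ vec i              ∎
      where open ≈-Reasoning ≈ᴹ-setoid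

    -- `θ* k` and the eigenvalue `η k` of the standard ordering both belong to `vec k`, hence agree,
    -- and distinctness transfers from `η`.
    dual-distinct : ∀ i j → θ* i ≈ θ* j → i ≡ j
    dual-distinct i j θ*ᵢ≈θ*ⱼ = IsEigenvalueOrdering.distinct ordering i j
      (trans (η≈θ* i) (trans θ*ᵢ≈θ*ⱼ (sym (η≈θ* j))))
      where
      η≈θ* : ∀ k → η k ≈ θ* k
      η≈θ* k = *ₗ-vec-cancel basis k (≈ᴹ-trans (≈ᴹ-sym (eigenvectors k)) (dual-eigenvector k))

    module _ (f₀ f₁ f₂ f₃ : Carrier) where
      private
        X = spanElement A A* f₀ f₁ f₂ f₃

      matrix-spanElement : ∀ i j → matrix basis X i j ≈
        (f₀ + f₁ * θ* j) * coord (vec j) i + (f₂ + f₃ * θ* j) * matrix basis A i j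
      matrix-spanElement i j = begin
        coord (⟦ X ⟧ (vec j)) i
          ≈⟨ coord-cong basis (spanElement-eigenvector A A* f₀ f₁ f₂ f₃ (dual-eigenvector j)) i ⟩
        coord ((f₀ + f₁ * θ* j) *ₗ vec j +ᴹ (f₂ + f₃ * θ* j) *ₗ ⟦ A ⟧ (vec j)) i
          ≈⟨ coord-homo-+ basis _ _ i ⟩
        coord ((f₀ + f₁ * θ* j) *ₗ vec j) i + coord ((f₂ + f₃ * θ* j) *ₗ ⟦ A ⟧ (vec j)) i
          ≈⟨ +-cong (coord-homo-*ₗ basis _ _ i) (coord-homo-*ₗ basis _ _ i) ⟩
        (f₀ + f₁ * θ* j) * coord (vec j) i + (f₂ + f₃ * θ* j) * matrix basis A i j ∎
        where open ≈-Reasoning setoid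

      matrix-spanElement-diagonal : ∀ i → matrix basis X i i ≈
        (f₀ + f₁ * θ* i) + (f₂ + f₃ * θ* i) * matrix basis A i i
      matrix-spanElement-diagonal i = trans (matrix-spanElement i i)
        (+-congʳ (trans (*-congˡ (coord-vec-≡ basis i)) (*-identityʳ _)))

      matrix-spanElement-offDiagonal : ∀ {i j} → i ≢ j → matrix basis X i j ≈
        (f₂ + f₃ * θ* j) * matrix basis A i j
      matrix-spanElement-offDiagonal {i} {j} i≢j = trans (matrix-spanElement i j)
        (trans (+-congʳ (trans (*-congˡ (coord-vec-≢ basis i≢j)) (zeroʳ _))) (+-identityˡ _))

      -- This bridges the two conditions: `trace-idempotent` turns the diagonal entry of `A` into
      -- the trace, and the rest is rearrangement into the form of the scalar relation.
      diagonal-trace : ∀ (b : Basis V (suc d)) i → matrix basis X i i ≈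
        f₀ + f₁ * θ* i + f₂ * trace b (E* i ∘ᴱ A) + f₃ * trace b (E* i ∘ᴱ A) * θ* i
      diagonal-trace b i = begin
        matrix basis X i i
          ≈⟨ matrix-spanElement-diagonal i ⟩
        f₀ + f₁ * θ* i + (f₂ + f₃ * θ* i) * matrix basis A i i
          ≈⟨ +-congˡ (*-congˡ (trace-idempotent standardE* b A i)) ⟨
        f₀ + f₁ * θ* i + (f₂ + f₃ * θ* i) * a
          ≈⟨ +-congˡ (distribʳ a f₂ (f₃ * θ* i)) ⟩
        f₀ + f₁ * θ* i + (f₂ * a + f₃ * θ* i * a)
          ≈⟨ +-assoc _ _ _ ⟨
        f₀ + f₁ * θ* i + f₂ * a + f₃ * θ* i * a
          ≈⟨ +-congˡ (xy∙z≈xz∙y f₃ (θ* i) a) ⟩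
        f₀ + f₁ * θ* i + f₂ * a + f₃ * a * θ* i ∎
        where
        open ≈-Reasoning setoid
        open Algebra.Properties.CommutativeSemigroup *-commutativeSemigroup using (xy∙z≈xz∙y)
        a = trace b (E* i ∘ᴱ A)

  -- The bound on `d` supplies the indices 0, 1, 2, and with them the two subdiagonal entries of `A`
  -- used to isolate `f₂` and `f₃`.
  spanElement-independent : IsField F → ∀ {d} → 2 ≤ d → (Φ : LeonardSystem V d) →
    let open LeonardSystem Φ in
    ∀ {θ*} → IsDualEigenvalueSequence Φ θ* →
    ∀ {f₀ f₁ f₂ f₃} → spanElement A A* f₀ f₁ f₂ f₃ ≈ᴱ 0ᴱ →
    f₀ ≈ 0# × f₁ ≈ 0# × f₂ ≈ 0# × f₃ ≈ 0#
  spanElement-independent isField (s≤s (s≤s _)) Φ {θ*} dual {f₀} {f₁} {f₂} {f₃} X≈0 =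
    proj₁ f₀₁≈0 , proj₂ f₀₁≈0 , proj₁ f₂₃≈0 , proj₂ f₂₃≈0
    where
    open LeonardSystem Φ
    open IsStandardOrdering standardE* using (basis; standard)
    open Basis basis
    open IsIrreducibleTridiagonal (proj₁ standard)
    open ≈-Reasoning setoid

    entry≈0 : ∀ i j → matrix basis (spanElement A A* f₀ f₁ f₂ f₃) i j ≈ 0#
    entry≈0 i j = trans (coord-cong basis (X≈0 (vec j)) i) (coord-0 basis i)

    θ*₀≉θ*₁ : θ* 0F ≉ θ* 1F
    θ*₀≉θ*₁ eq with () ← dual-distinct Φ dual 0F 1F eq

    subdiagonal : ∀ {i j} → i ≢ j → matrix basis A i j ≉ 0# → f₂ + f₃ * θ* j ≈ 0#
    subdiagonal {i} {j} i≢j Aᵢⱼ≉0 = *-cancel-zeroʳ F isField Aᵢⱼ≉0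
      (trans (sym (matrix-spanElement-offDiagonal Φ dual f₀ f₁ f₂ f₃ i≢j)) (entry≈0 i j))

    f₂₃≈0 : f₂ ≈ 0# × f₃ ≈ 0#
    -- The affine function with coefficients `f₂`, `f₃` vanishes at the distinct points `θ* 0F` and
    -- `θ* 1F`, because the entries (1,0) and (2,1) of `A` are nonzero.
    f₂₃≈0 = affine-zero F isField θ*₀≉θ*₁
      (subdiagonal (λ ()) (irreducible 1F 0F ≡.refl))
      (subdiagonal (λ ()) (irreducible 2F 1F ≡.refl))

    diagonal : ∀ j → f₀ + f₁ * θ* j ≈ 0#
    diagonal j = begin
      f₀ + f₁ * θ* j
        ≈⟨ +-identityʳ _ ⟨
      f₀ + f₁ * θ* j + 0#
        ≈⟨ +-congˡ (trans (*-congʳ f₂+f₃θ*ⱼ≈0) (zeroˡ _)) ⟨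
      f₀ + f₁ * θ* j + (f₂ + f₃ * θ* j) * matrix basis A j j
        ≈⟨ matrix-spanElement-diagonal Φ dual f₀ f₁ f₂ f₃ j ⟨
      matrix basis (spanElement A A* f₀ f₁ f₂ f₃) j j
        ≈⟨ entry≈0 j j ⟩
      0# ∎
      where
      f₂+f₃θ*ⱼ≈0 : f₂ + f₃ * θ* j ≈ 0#
      f₂+f₃θ*ⱼ≈0 = trans
        (+-cong (proj₁ f₂₃≈0) (trans (*-congʳ (proj₂ f₂₃≈0)) (zeroˡ _))) (+-identityˡ 0#)

    f₀₁≈0 : f₀ ≈ 0# × f₁ ≈ 0#
    f₀₁≈0 = affine-zero F isField θ*₀≉θ*₁ (diagonal 0F) (diagonal 1F)

-- Nonzero zero-diagonal elements and scalar relations between `θ*` and `a`.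

lemma5p2 :
  ∀ {r ℓr m ℓm} (F : CommutativeRing r ℓr) → IsField F → IsAlgebraicallyClosed F →
  (V : Module F m ℓm) (d : ℕ) → 3 ≤ d → (b : Basis V (suc d)) →
  (Φ : LeonardSystem V d) →
  let open CommutativeRing F
      open LeonardSystem Φ in
  (θ* : Fin (suc d) → Carrier) → IsDualEigenvalueSequence Φ θ* →
  let a : Fin (suc d) → Carrier
      a i = trace b (E* i ∘ᴱ A) in
  (∃ λ X → ZeroDiagonalSpace Φ X × ¬ (X ≈ᴱ 0ᴱ))
    ⇔
  (∃₂ λ f₀ f₁ → ∃₂ λ f₂ f₃ →
    ¬ (f₀ ≈ 0# × f₁ ≈ 0# × f₂ ≈ 0# × f₃ ≈ 0#) ×
    (∀ i → f₀ + f₁ * θ* i + f₂ * a i + f₃ * a i * θ* i ≈ 0#))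
lemma5p2 F isField _ V d 3≤d b Φ θ* dual = mk⇔ to from
  where
  open CommutativeRing F
  open Module V
  open LeonardSystem Φ
  open IsStandardOrdering standardE* using (basis)

  a : Fin (suc d) → Carrier
  a i = trace b (E* i ∘ᴱ A)

  to : (∃ λ X → ZeroDiagonalSpace Φ X × ¬ (X ≈ᴱ 0ᴱ)) →
       ∃₂ λ f₀ f₁ → ∃₂ λ f₂ f₃ →
         ¬ (f₀ ≈ 0# × f₁ ≈ 0# × f₂ ≈ 0# × f₃ ≈ 0#) ×
         (∀ i → f₀ + f₁ * θ* i + f₂ * a i + f₃ * a i * θ* i ≈ 0#)
  to (X , ((f₀ , f₁ , f₂ , f₃ , X≈f) , EXE≈0) , X≉0) = f₀ , f₁ , f₂ , f₃ ,
    -- If all coefficients vanished, so would `X`.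
    (λ f≈0 → X≉0 (λ v → ≈ᴹ-trans (X≈f v) (spanElement-zero A A* f≈0 v))) ,
    (λ i → trans (sym (diagonal-trace Φ dual f₀ f₁ f₂ f₃ b i))
      -- `X` is only pointwise equal to the combination, so its diagonal entry is carried over
      -- before the sandwich condition is applied.
      (trans (coord-cong basis (≈ᴹ-sym (X≈f (Basis.vec basis i))) i)
        (sandwich-zero⇒diagonal-zero standardE* X i (EXE≈0 i))))

  from : (∃₂ λ f₀ f₁ → ∃₂ λ f₂ f₃ →
           ¬ (f₀ ≈ 0# × f₁ ≈ 0# × f₂ ≈ 0# × f₃ ≈ 0#) ×
           (∀ i → f₀ + f₁ * θ* i + f₂ * a i + f₃ * a i * θ* i ≈ 0#)) →
         ∃ λ X → ZeroDiagonalSpace Φ X × ¬ (X ≈ᴱ 0ᴱ)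
  from (f₀ , f₁ , f₂ , f₃ , f≉0 , f≈0) = X ,
    -- `spanElement` unfolds to the very expression in `InSpan`, so reflexivity suffices.
    ((f₀ , f₁ , f₂ , f₃ , λ _ → ≈ᴹ-refl) ,
     (λ i → diagonal-zero⇒sandwich-zero standardE* X i
       (trans (diagonal-trace Φ dual f₀ f₁ f₂ f₃ b i) (f≈0 i)))) ,
    (λ X≈0 → f≉0 (spanElement-independent isField (≤-trans (n≤1+n 2) 3≤d) Φ dual X≈0))
    where X = spanElement A A* f₀ f₁ f₂ f₃
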